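{- Let $a\ge 2$, $c>0$, $d$ be integers with $d<ca$ and $\gcd(d,a)=\gcd(d,c)=1$, let $n\ge 1$, and let $\mathbf s_j=ca^{n+j}-d$ for $j\in\mathbb N$ and $S_n=\langle\{\mathbf s_j:j\in\mathbb N\}\rangle$. Suppose that $d>0$ and let $\lambda=\gcd(S_n)$. If $m$ is the smallest positive integer such that $\mathbf s_0/\lambda\le\mathbf R_m$, then $e(S_n)=m$.
   Context: $\mathbb N=\{0,1,2,\ldots\}$. For $A\subseteq\mathbb N$, $\langle A\rangle$ is the submonoid of $(\mathbb N,+)$ generated by $A$. For a nontrivial submonoid $M$ of $\mathbb N$, the minimal generating set of $M$ is the unique generating set contained in every generating set of $M$ (its elements are the nonzero elements of $M$ that are not sums of two nonzero elements of $M$; it is finite), and $e(M)$ is its cardinality. $\gcd(M)$ denotes the greatest common divisor of all elements of $M$. The repunit numbers in base $a$ are $\mathbf R_0=0$ and $\mathbf R_k=1+a+\cdots+a^{k-1}=(a^k-1)/(a-1)$ for $k\ge 1$. -}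

module Defs where

open import Data.Fin.Base using (Fin)
open import Data.Integer.Base as ℤ using (ℤ; +_)
open import Data.Nat.Base using (ℕ; zero; suc; _+_; _*_; _^_; _≤_)
open import Data.Nat.Divisibility using (_∣_)
open import Data.Product.Base using (Σ-syntax; ∃-syntax; _×_)
open import Function.Definitions using (Injective)
open import Level using (0ℓ) renaming (suc to lsuc)
open import Relation.Binary.PropositionalEquality using (_≡_)
open import Relation.Unary using (Pred; _∈_; _⊆_; _≐_)

data ⟨_⟩ (A : Pred ℕ 0ℓ) : Pred ℕ 0ℓ where
  gen  : ∀ {x} → x ∈ A → x ∈ ⟨ A ⟩
  zero : 0 ∈ ⟨ A ⟩
  add  : ∀ {x y} → x ∈ ⟨ A ⟩ → y ∈ ⟨ A ⟩ → x + y ∈ ⟨ A ⟩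

_Generates_ : Pred ℕ 0ℓ → Pred ℕ 0ℓ → Set
A Generates M = ⟨ A ⟩ ≐ M

-- Such an A is unique up to _≐_.
IsMinimalGeneratingSet : Pred ℕ 0ℓ → Pred ℕ 0ℓ → Set (lsuc 0ℓ)
IsMinimalGeneratingSet M A =
  A Generates M × (∀ (B : Pred ℕ 0ℓ) → B Generates M → A ⊆ B)

-- A is enumerated without repetition by Fin k.  A bijection with the type
-- Σ ℕ A would instead count proofs of membership.
HasCardinality : Pred ℕ 0ℓ → ℕ → Set
HasCardinality A k =
  Σ[ f ∈ (Fin k → ℕ) ] Injective _≡_ _≡_ f × (A ≐ λ x → ∃[ i ] f i ≡ x)

-- The relation e(M) = k.
EmbeddingDimension : Pred ℕ 0ℓ → ℕ → Set (lsuc 0ℓ)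
EmbeddingDimension M k =
  Σ[ A ∈ Pred ℕ 0ℓ ] IsMinimalGeneratingSet M A × HasCardinality A k

-- As for GCD in Data.Nat.GCD, "greatest" refers to the divisibility order.
record IsGCD (M : Pred ℕ 0ℓ) (g : ℕ) : Set where
  field
    commonDivisor : ∀ {x} → x ∈ M → g ∣ x
    greatest      : ∀ {k} → (∀ {x} → x ∈ M → k ∣ x) → k ∣ g

IsLeast : Pred ℕ 0ℓ → ℕ → Set
IsLeast P m = m ∈ P × (∀ {k} → k ∈ P → m ≤ k)

repunit : ℕ → ℕ → ℕ
repunit a zero    = 0
repunit a (suc k) = repunit a k + a ^ k

s : (a c : ℕ) (d : ℤ) (n j : ℕ) → ℤ
s a c d n j = + (c * a ^ (n + j)) ℤ.- d

-- When d < c a and n ≥ 1, every s a c d n j is positive, so none of the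
-- generators is lost by passing to ℕ.
S : (a c : ℕ) (d : ℤ) (n : ℕ) → Pred ℕ 0ℓ
S a c d n = ⟨ (λ x → ∃[ j ] + x ≡ s a c d n j) ⟩

-- Put C = c aⁿ, u = C - d and b = a - 1, so that s_j = u + b C R_j.  With g the
-- gcd, u = g q and b = g k where q is coprime to k C.  If u X + b C Y = s_j, then
-- q (X - 1) = k C (R_j - Y), hence X = 1 as soon as R_j < q: the s_j with j < m
-- are irreducible.  For j ≥ m, write R_j = r + t q with r < q ≤ R_m; then
-- s_j = u (1 + t k C) + b C r, and a greedy expansion of r in repunits uses few
-- enough digits (at most a - 1 per place, except for one possible a) to be padded
-- with copies of s_0 = u to a sum of exactly 1 + t k C generators.
module Submission where

open import Defs
open import Data.Fin.Base using (Fin; toℕ; fromℕ<)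
open import Data.Fin.Properties using (toℕ-fromℕ<; toℕ-injective; toℕ<n)
open import Data.Integer.Base as ℤ using (ℤ; +_; 0ℤ; 1ℤ)
open import Data.Integer.DivMod using (_/ℕ_)
open import Data.Integer.GCD using (gcd)
import Data.Integer.Properties as ℤ
open import Data.Nat.Base
  using (ℕ; zero; suc; _+_; _*_; _^_; _∸_; _≤_; _<_; z≤n; s≤s; z<s; NonZero; >-nonZero; >-nonZero⁻¹)
open import Data.Nat.Coprimality
  using (Coprime; coprime-divisor; gcd≡1⇒coprime)
open import Data.Nat.Divisibility
  using (_∣_; divides; quotient; ∣-trans; ∣m∣n⇒∣m+n; ∣m+n∣m⇒∣n; ∣m⇒∣m*n; ∣n⇒∣m*n; *-monoʳ-∣; *-cancelˡ-∣; ∣⇒≤; ∣1⇒≡1)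
open import Data.Nat.DivMod
  using (_/_; _%_; m≡m%n+[m/n]*n; m%n<n; m*n/n≡m; m≥n⇒m/n>0; m<n*o⇒m/o<n; /-congˡ)
open import Data.Nat.Properties
open import Data.Nat.Tactic.RingSolver using (solve-∀)
open import Data.Product.Base using (∃-syntax; _×_; _,_; proj₂)
open import Data.Sum.Base using (_⊎_; inj₁; inj₂)
open import Function.Base using (_∘_)
open import Level using (0ℓ)
open import Relation.Binary.PropositionalEquality
  using (_≡_; _≢_; refl; sym; trans; cong; cong₂; subst; module ≡-Reasoning)
open import Relation.Nullary using (yes; no; contradiction)
open import Relation.Unary using (Pred; _∈_; _⊆_; _≐_)

-- Generated submonoids and irreducible elements.

⟨⟩-least : ∀ {A B : Pred ℕ 0ℓ} → A ⊆ ⟨ B ⟩ → ⟨ A ⟩ ⊆ ⟨ B ⟩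
⟨⟩-least A⊆⟨B⟩ (gen x∈A) = A⊆⟨B⟩ x∈A
⟨⟩-least A⊆⟨B⟩ zero      = zero
⟨⟩-least A⊆⟨B⟩ (add p q) = add (⟨⟩-least A⊆⟨B⟩ p) (⟨⟩-least A⊆⟨B⟩ q)

⟨⟩-multiple : ∀ {A : Pred ℕ 0ℓ} {x} k → x ∈ ⟨ A ⟩ → k * x ∈ ⟨ A ⟩
⟨⟩-multiple zero    x∈ = zero
⟨⟩-multiple (suc k) x∈ = add x∈ (⟨⟩-multiple k x∈)

Irreducible : Pred ℕ 0ℓ → Pred ℕ 0ℓ
Irreducible M z = z ≢ 0 × (∀ {x y} → x ∈ M → y ∈ M → x + y ≡ z → x ≡ 0 ⊎ y ≡ 0)

-- By induction on the derivation of `z`: in a sum equal to `z` one summand vanishes, so the other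
-- is again `z`, with a shorter derivation.
irreducible∈generators : ∀ {B M : Pred ℕ 0ℓ} {z} → ⟨ B ⟩ ⊆ M →
                         Irreducible M z → z ∈ ⟨ B ⟩ → z ∈ B
irreducible∈generators ⟨B⟩⊆M irr (gen z∈B) = z∈B
irreducible∈generators ⟨B⟩⊆M (z≢0 , _) zero = contradiction refl z≢0
irreducible∈generators {B} ⟨B⟩⊆M irr (add {x} {y} x∈ y∈)
  with proj₂ irr (⟨B⟩⊆M x∈) (⟨B⟩⊆M y∈) refl
... | inj₁ refl = irreducible∈generators ⟨B⟩⊆M irr y∈
... | inj₂ refl = subst B (sym (+-identityʳ x))
  (irreducible∈generators ⟨B⟩⊆M (subst (Irreducible _) (+-identityʳ x) irr) x∈)

irreducibleGenerators⇒minimal : ∀ {M A : Pred ℕ 0ℓ} → A Generates M →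
                                A ⊆ Irreducible M → IsMinimalGeneratingSet M A
irreducibleGenerators⇒minimal (⟨A⟩⊆M , M⊆⟨A⟩) irr = (⟨A⟩⊆M , M⊆⟨A⟩) , λ B (⟨B⟩⊆M , M⊆⟨B⟩) x∈A →
  irreducible∈generators ⟨B⟩⊆M (irr x∈A) (M⊆⟨B⟩ (⟨A⟩⊆M (gen x∈A)))

-- Repunits in base `suc b`.

repunit-geometric : ∀ b k → suc b ^ k ≡ 1 + b * repunit (suc b) k
repunit-geometric b zero    = cong suc (sym (*-zeroʳ b))
repunit-geometric b (suc k) = begin
  suc b * suc b ^ k                 ≡⟨ lemma b (suc b ^ k) ⟩
  suc b ^ k + b * suc b ^ k         ≡⟨ cong (_+ b * suc b ^ k) (repunit-geometric b k) ⟩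
  1 + b * R + b * suc b ^ k         ≡⟨ cong suc (*-distribˡ-+ b R (suc b ^ k)) ⟨
  1 + b * (R + suc b ^ k)           ∎
  where
  open ≡-Reasoning
  R = repunit (suc b) k
  lemma : ∀ b x → suc b * x ≡ x + b * x
  lemma = solve-∀

-- Splits off the lowest digit, whereas the definition splits off the highest. It turns
-- `N < R (suc p)` into `N ≤ suc b * R p`, the bound on which the greedy expansion runs.
repunit-suc : ∀ b k → repunit (suc b) (suc k) ≡ 1 + suc b * repunit (suc b) k
repunit-suc b k = trans (cong (λ x → repunit (suc b) k + x) (repunit-geometric b k))
  (lemma b (repunit (suc b) k))
  where
  lemma : ∀ b x → x + (1 + b * x) ≡ 1 + suc b * x
  lemma = solve-∀

repunit-<-suc : ∀ b k → repunit (suc b) k < repunit (suc b) (suc k)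
repunit-<-suc b k = ≤-trans (s≤s (m≤m+n _ _)) (≤-reflexive (sym (repunit-suc b k)))

repunit-mono-< : ∀ b {i j} → i < j → repunit (suc b) i < repunit (suc b) j
repunit-mono-< b {i} {suc j} (s≤s i≤j) with m≤n⇒m<n∨m≡n i≤j
... | inj₁ i<j  = <-trans (repunit-mono-< b i<j) (repunit-<-suc b j)
... | inj₂ refl = repunit-<-suc b j

repunit-mono-≤ : ∀ b {i j} → i ≤ j → repunit (suc b) i ≤ repunit (suc b) j
repunit-mono-≤ b i≤j with m≤n⇒m<n∨m≡n i≤j
... | inj₁ i<j  = <⇒≤ (repunit-mono-< b i<j)
... | inj₂ refl = ≤-refl

0<repunit⇒0< : ∀ a {k} → 0 < repunit a k → 0 < k
0<repunit⇒0< a {suc k} _ = z<s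

n≤repunit : ∀ b n → n ≤ repunit (suc b) n
n≤repunit b zero    = z≤n
n≤repunit b (suc n) = ≤-<-trans (n≤repunit b n) (repunit-<-suc b n)

repunit-injective : ∀ b {i j} → repunit (suc b) i ≡ repunit (suc b) j → i ≡ j
repunit-injective b {i} {j} eq = ≤-antisym
  (≮⇒≥ λ j<i → <-irrefl (sym eq) (repunit-mono-< b j<i))
  (≮⇒≥ λ i<j → <-irrefl eq (repunit-mono-< b i<j))

-- Sums of the terms `u + b C R_j`, and greedy expansion.

module _ (b C u : ℕ) where

  private
    w = b * C
    R = repunit (suc b)

  term : ℕ → ℕ
  term j = u + w * R j

  Terms : Pred ℕ 0ℓ
  Terms x = ∃[ j ] x ≡ term j

  -- Indexed by `Fin m`, in the very form that `HasCardinality` asks for, so that the enumeration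
  -- holds by definition.
  TermsBelow : ℕ → Pred ℕ 0ℓ
  TermsBelow m x = ∃[ i ] term (toℕ {m} i) ≡ x

  term∈⟨TermsBelow⟩ : ∀ {m j} → j < m → term j ∈ ⟨ TermsBelow m ⟩
  term∈⟨TermsBelow⟩ j<m = gen (fromℕ< j<m , cong term (toℕ-fromℕ< j<m))

  -- `suc X` counts the generators used and `Y` adds up their repunits. The empty sum is kept apart,
  -- so `X` is zero exactly when a single generator is used.
  ⟨Terms⟩-form : ∀ {x} → x ∈ ⟨ Terms ⟩ → x ≡ 0 ⊎ ∃[ X ] ∃[ Y ] x ≡ u * suc X + w * Y
  ⟨Terms⟩-form (gen (j , eq)) = inj₂ (0 , R j , trans eq (cong (_+ w * R j) (sym (*-identityʳ u))))
  ⟨Terms⟩-form zero           = inj₁ refl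
  ⟨Terms⟩-form (add p q) with ⟨Terms⟩-form p | ⟨Terms⟩-form q
  ... | inj₁ refl          | y-form = y-form
  ... | inj₂ (X , Y , eq)  | inj₁ refl = inj₂ (X , Y , trans (+-identityʳ _) eq)
  ... | inj₂ (X₁ , Y₁ , eq₁) | inj₂ (X₂ , Y₂ , eq₂) =
    inj₂ (X₁ + suc X₂ , Y₁ + Y₂ , trans (cong₂ _+_ eq₁ eq₂) (lemma u w X₁ X₂ Y₁ Y₂))
    where
    lemma : ∀ u w X₁ X₂ Y₁ Y₂ → (u * suc X₁ + w * Y₁) + (u * suc X₂ + w * Y₂) ≡
                                u * suc (X₁ + suc X₂) + w * (Y₁ + Y₂)
    lemma = solve-∀

  -- The bound on N is R (suc p) - 1, so the leading digit can only be a = suc b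
  -- when the remaining ones vanish.
  greedy : ∀ {A : Pred ℕ 0ℓ} p → (∀ {i} → i ≤ p → term i ∈ ⟨ A ⟩) → ∀ {N X} →
           N ≤ suc b * R p → b * p < X → u * X + w * N ∈ ⟨ A ⟩
  greedy {A} zero term∈ {N} {X} N≤ _ = subst ⟨ A ⟩ (sym eq) (⟨⟩-multiple X (term∈ z≤n))
    where
    N≡0 : N ≡ 0
    N≡0 = n≤0⇒n≡0 (≤-trans N≤ (≤-reflexive (*-zeroʳ (suc b))))
    lemma : ∀ u w X → u * X + w * 0 ≡ X * (u + w * 0)
    lemma = solve-∀
    eq : u * X + w * N ≡ X * term 0
    eq = trans (cong (λ N → u * X + w * N) N≡0) (lemma u w X)
  greedy {A} (suc p) term∈ {N} {X} N≤ X> with m≤n⇒m<n∨m≡n N≤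
  ... | inj₂ refl = subst ⟨ A ⟩ eq
      (add (⟨⟩-multiple (suc b) (term∈ ≤-refl)) (⟨⟩-multiple (X ∸ suc b) (term∈ z≤n)))
    where
    -- The digit `suc b` exceeds the usual bound `b` by one; the strictness of `b * suc p < X` pays
    -- for it.
    a≤X : suc b ≤ X
    a≤X = ≤-trans (s≤s (m≤m*n b (suc p))) X>
    lemma : ∀ u w a r e → a * (u + w * r) + e * (u + w * 0) ≡ u * (a + e) + w * (a * r)
    lemma = solve-∀
    eq : suc b * term (suc p) + (X ∸ suc b) * term 0 ≡ u * X + w * (suc b * R (suc p))
    eq = trans (lemma u w (suc b) (R (suc p)) (X ∸ suc b))
      (cong (λ X → u * X + w * (suc b * R (suc p))) (m+[n∸m]≡n a≤X))
  ... | inj₁ N< = subst ⟨ A ⟩ eq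
      (add (⟨⟩-multiple x (term∈ ≤-refl)) (greedy p (term∈ ∘ m≤n⇒m≤1+n) N′≤ X′>))
    where
    instance
      R≢0 : NonZero (R (suc p))
      R≢0 = >-nonZero (≤-trans z<s (n≤repunit b (suc p)))
    x N′ : ℕ
    x  = N / R (suc p)
    N′ = N % R (suc p)
    x≤b : x ≤ b
    x≤b = ≤-pred (m<n*o⇒m/o<n N<)
    -- A remainder modulo `R (suc p) = 1 + suc b * R p` meets the bound for the next lower place.
    N′≤ : N′ ≤ suc b * R p
    N′≤ = ≤-pred (≤-trans (m%n<n N (R (suc p))) (≤-reflexive (repunit-suc b p)))
    x+bp<X : x + b * p < X
    x+bp<X = ≤-<-trans (≤-trans (+-monoˡ-≤ (b * p) x≤b) (≤-reflexive (sym (*-suc b p)))) X>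
    X′> : b * p < X ∸ x
    X′> = m+n≤o⇒m≤o∸n (suc (b * p)) (≤-trans (≤-reflexive (cong suc (+-comm (b * p) x))) x+bp<X)
    lemma : ∀ u w x r e N′ → x * (u + w * r) + (u * e + w * N′) ≡ u * (x + e) + w * (N′ + x * r)
    lemma = solve-∀
    eq : x * term (suc p) + (u * (X ∸ x) + w * N′) ≡ u * X + w * N
    eq = trans (lemma u w x (R (suc p)) (X ∸ x) N′)
      (cong₂ (λ X N → u * X + w * N)
        (m+[n∸m]≡n (≤-trans (m≤m+n x (b * p)) (<⇒≤ x+bp<X)))
        (sym (m≡m%n+[m/n]*n N (R (suc p)))))

-- Irreducible and redundant terms when `u = g q`, `b = g k` and `q` is coprime to `k C`.

module _ (b C q g k : ℕ) .{{_ : NonZero g}} .{{_ : NonZero q}} .{{_ : NonZero C}} .{{_ : NonZero k}}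
         (b≡gk : b ≡ g * k) (coprime : Coprime q (k * C)) (u≤C : g * q ≤ C) where

  private
    u = g * q
    R = repunit (suc b)
    instance
      u≢0 : NonZero u
      u≢0 = m*n≢0 g q
      D≢0 : NonZero (k * C)
      D≢0 = m*n≢0 k C

  -- Cancelling `g` and one `q` leaves `q * X ≡ k * C * (r ∸ Y)`. By coprimality `q` divides
  -- `r ∸ Y`, which is less than `q` and hence zero.
  coefficient-rigid : ∀ {X Y r} → r < q → u * suc X + b * C * Y ≡ u + b * C * r → X ≡ 0
  coefficient-rigid {X} {Y} {r} r<q eq = m*n≡0⇒m≡0 X q
    (trans (*-comm X q) (trans qX≡Dz (trans (cong (k * C *_) z≡0) (*-zeroʳ (k * C)))))
    where
    lemma₁ : ∀ g q k C X Y → g * (q + (q * X + k * C * Y)) ≡ g * q * suc X + g * k * C * Y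
    lemma₁ = solve-∀
    lemma₂ : ∀ g q k C r → g * q + g * k * C * r ≡ g * (q + k * C * r)
    lemma₂ = solve-∀
    eq₁ : q * X + k * C * Y ≡ k * C * r
    eq₁ = +-cancelˡ-≡ q _ _ (*-cancelˡ-≡ _ _ g (trans (lemma₁ g q k C X Y)
      (trans (subst (λ b → u * suc X + b * C * Y ≡ u + b * C * r) b≡gk eq) (lemma₂ g q k C r))))
    Y≤r : Y ≤ r
    Y≤r = *-cancelˡ-≤ (k * C) (≤-trans (m≤n+m _ (q * X)) (≤-reflexive eq₁))
    z = r ∸ Y
    qX≡Dz : q * X ≡ k * C * z
    qX≡Dz = +-cancelʳ-≡ (k * C * Y) _ _ (trans eq₁ (trans
      (cong (k * C *_) (sym (m∸n+n≡m Y≤r))) (*-distribˡ-+ (k * C) z Y)))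
    q∣z : q ∣ z
    q∣z = coprime-divisor coprime (divides X (trans (sym qX≡Dz) (*-comm q X)))
    z≡0 : z ≡ 0
    z≡0 with z in z≡
    ... | zero  = refl
    ... | suc _ = contradiction (∣⇒≤ (subst (q ∣_) z≡ q∣z))
      (<⇒≱ (≤-<-trans (≤-trans (≤-reflexive (sym z≡)) (m∸n≤m r Y)) r<q))

  -- Two nonzero summands would use at least two generators between them, but rigidity allows only
  -- one.
  term-irreducible : ∀ {j} → R j < q → Irreducible ⟨ Terms b C u ⟩ (term b C u j)
  term-irreducible {j} Rj<q = (λ eq → m<n⇒n≢0 (>-nonZero⁻¹ u) (m+n≡0⇒m≡0 u eq)) , irr
    where
    irr : ∀ {x y} → x ∈ ⟨ Terms b C u ⟩ → y ∈ ⟨ Terms b C u ⟩ → x + y ≡ term b C u j → x ≡ 0 ⊎ y ≡ 0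
    irr x∈ y∈ eq with ⟨Terms⟩-form b C u x∈ | ⟨Terms⟩-form b C u y∈
    ... | inj₁ x≡0 | _ = inj₁ x≡0
    ... | inj₂ _ | inj₁ y≡0 = inj₂ y≡0
    ... | inj₂ (X₁ , Y₁ , eq₁) | inj₂ (X₂ , Y₂ , eq₂) = contradiction
      (coefficient-rigid {X₁ + suc X₂} {Y₁ + Y₂} Rj<q
        (trans (lemma u (b * C) X₁ X₂ Y₁ Y₂) (trans (sym (cong₂ _+_ eq₁ eq₂)) eq)))
      (m<n⇒n≢0 (≤-trans z<s (m≤n+m (suc X₂) X₁)))
      where
      lemma : ∀ u w X₁ X₂ Y₁ Y₂ → u * suc (X₁ + suc X₂) + w * (Y₁ + Y₂) ≡
                                  (u * suc X₁ + w * Y₁) + (u * suc X₂ + w * Y₂)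
      lemma = solve-∀

  -- Since `b * C * q ≡ u * (k * C)`, each `q` taken out of `R j` buys `k * C` further copies of
  -- `u`. What is left of `R j` is a remainder modulo `q`, small enough for `greedy`.
  term-reducible : ∀ {p} → p ≤ q → q ≤ R (suc p) → ∀ {j} → suc p ≤ j →
                   term b C u j ∈ ⟨ TermsBelow b C u (suc p) ⟩
  term-reducible {p} p≤q q≤R {j} p<j = subst ⟨ TermsBelow b C u (suc p) ⟩ eq
    (greedy b C u p (λ i≤p → term∈⟨TermsBelow⟩ b C u (s≤s i≤p)) N≤ X>)
    where
    t N : ℕ
    t = R j / q
    N = R j % q
    N≤ : N ≤ suc b * R p
    N≤ = ≤-pred (≤-trans (m%n<n (R j) q) (≤-trans q≤R (≤-reflexive (repunit-suc b p))))
    -- `q ≤ R (suc p) ≤ R j` makes the quotient at least 1, so at least `k * C` copies of `u` are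
    -- gained.
    instance
      t≢0 : NonZero t
      t≢0 = >-nonZero (m≥n⇒m/n>0 (≤-trans q≤R (repunit-mono-≤ b p<j)))
    X> : b * p < suc (t * (k * C))
    X> = s≤s (begin
      -- The digits need at most `b * p ≤ b * q = k * u` generators, and `u ≤ C` bounds this by
      -- `k * C`.
      b * p             ≤⟨ *-monoʳ-≤ b p≤q ⟩
      b * q             ≡⟨ cong (_* q) (trans b≡gk (*-comm g k)) ⟩
      k * g * q         ≡⟨ *-assoc k g q ⟩
      k * (g * q)       ≤⟨ *-monoʳ-≤ k u≤C ⟩
      k * C             ≤⟨ m≤n*m (k * C) t ⟩
      t * (k * C)       ∎)
      where open ≤-Reasoning
    lemma : ∀ g q k C t N → g * q * suc (t * (k * C)) + g * k * C * N ≡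
                            g * q + g * k * C * (N + t * q)
    lemma = solve-∀
    eq : u * suc (t * (k * C)) + b * C * N ≡ term b C u j
    eq = begin
      u * suc (t * (k * C)) + b * C * N
        ≡⟨ subst (λ b → u * suc (t * (k * C)) + b * C * N ≡ u + b * C * (N + t * q))
             (sym b≡gk) (lemma g q k C t N) ⟩
      u + b * C * (N + t * q)
        ≡⟨ cong (λ r → u + b * C * r) (m≡m%n+[m/n]*n (R j) q) ⟨
      term b C u j ∎
      where open ≡-Reasoning

  -- The two bounds on `q` divide the work: the first makes every term of index at most `p`
  -- irreducible, the second makes all later terms redundant.
  terms-embeddingDimension : ∀ {p} → R p < q → q ≤ R (suc p) →
                             EmbeddingDimension ⟨ Terms b C u ⟩ (suc p)
  terms-embeddingDimension {p} Rp<q q≤R =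
    TermsBelow b C u (suc p) ,
    irreducibleGenerators⇒minimal
      (⟨⟩-least (λ { (i , refl) → gen (toℕ i , refl) }) , ⟨⟩-least below)
      (λ { (i , refl) → term-irreducible {toℕ i}
        (≤-<-trans (repunit-mono-≤ b (≤-pred (toℕ<n i))) Rp<q) }) ,
    ((λ i → term b C u (toℕ i)) , term-injective , (λ x → x) , (λ x → x))
    where
    instance
      w≢0 : NonZero (b * C)
      w≢0 = m*n≢0 b C {{subst NonZero (sym b≡gk) (m*n≢0 g k)}}
    below : Terms b C u ⊆ ⟨ TermsBelow b C u (suc p) ⟩
    below (j , refl) with j <? suc p
    ... | yes j<m = term∈⟨TermsBelow⟩ b C u j<m
    ... | no  j≮m = term-reducible (≤-trans (n≤repunit b p) (<⇒≤ Rp<q)) q≤R (≮⇒≥ j≮m)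
    term-injective : ∀ {i j : Fin (suc p)} → term b C u (toℕ i) ≡ term b C u (toℕ j) → i ≡ j
    term-injective eq = toℕ-injective
      (repunit-injective b (*-cancelˡ-≡ _ _ (b * C) (+-cancelˡ-≡ u _ _ eq)))

-- Coprimality, and the passage from the integers `s_j` to natural terms.

coprime-* : ∀ {m k l} → Coprime m k → Coprime m l → Coprime m (k * l)
coprime-* m⊥k m⊥l {d} (d∣m , d∣kl) = m⊥l (d∣m , coprime-divisor d⊥k d∣kl)
  where
  d⊥k : Coprime d _
  d⊥k (e∣d , e∣k) = m⊥k (∣-trans e∣d d∣m , e∣k)

coprime-^ : ∀ {m k} → Coprime m k → ∀ n → Coprime m (k ^ n)
coprime-^ m⊥k zero    = ∣1⇒≡1 ∘ proj₂
coprime-^ m⊥k (suc n) = coprime-* m⊥k (coprime-^ m⊥k n)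

coprime-summand : ∀ {d u C} → d + u ≡ C → Coprime d C → Coprime u C
coprime-summand {d} {u} refl d⊥C {e} (e∣u , e∣C) =
  d⊥C (∣m+n∣m⇒∣n (subst (e ∣_) (+-comm d u) e∣C) e∣u , e∣C)

-- From `a ^ j = 1 + b R_j` one gets `C * a ^ j = C + b C R_j`; subtracting `d` turns the leading
-- `C` into `u`.
s≡term : ∀ b c d n u → d + u ≡ c * suc b ^ n → ∀ j →
         s (suc b) c (+ d) n j ≡ + term b (c * suc b ^ n) u j
s≡term b c d n u d+u≡C j = trans (cong (λ x → + x ℤ.- + d) C′≡)
  (trans (ℤ.m-n≡m⊖n (d + v) d) (trans (ℤ.⊖-≥ (m≤m+n d v)) (cong +_ (m+n∸m≡n d v))))
  where
  C v : ℕ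
  C = c * suc b ^ n
  v = term b C u j
  lemma : ∀ C b r → C * (1 + b * r) ≡ C + b * C * r
  lemma = solve-∀
  C′≡ : c * suc b ^ (n + j) ≡ d + v
  C′≡ = begin
    c * suc b ^ (n + j)                 ≡⟨ cong (c *_) (^-distribˡ-+-* (suc b) n j) ⟩
    c * (suc b ^ n * suc b ^ j)         ≡⟨ *-assoc c _ _ ⟨
    C * suc b ^ j                       ≡⟨ cong (C *_) (repunit-geometric b j) ⟩
    C * (1 + b * repunit (suc b) j)     ≡⟨ lemma C b _ ⟩
    C + b * C * repunit (suc b) j       ≡⟨ cong (_+ b * C * repunit (suc b) j) d+u≡C ⟨
    d + u + b * C * repunit (suc b) j   ≡⟨ +-assoc d u _ ⟩
    d + v                               ∎
    where open ≡-Reasoning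

embeddingDimension-resp-≐ : ∀ {M N : Pred ℕ 0ℓ} {k} → M ≐ N →
                            EmbeddingDimension M k → EmbeddingDimension N k
embeddingDimension-resp-≐ (M⊆N , N⊆M) (A , ((⟨A⟩⊆M , M⊆⟨A⟩) , minimal) , card) =
  A , ((M⊆N ∘ ⟨A⟩⊆M , M⊆⟨A⟩ ∘ N⊆M) ,
       λ B (⟨B⟩⊆N , N⊆⟨B⟩) → minimal B (N⊆M ∘ ⟨B⟩⊆N , N⊆⟨B⟩ ∘ M⊆N)) ,
  card

proposition3p10 : (a c : ℕ) (d : ℤ) (n : ℕ) →
    2 ≤ a → 0 < c → d ℤ.< + (c * a) →
    gcd d (+ a) ≡ 1ℤ → gcd d (+ c) ≡ 1ℤ →
    1 ≤ n →
    0ℤ ℤ.< d →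
    (g : ℕ) .{{_ : NonZero g}} → IsGCD (S a c d n) g →
    (m : ℕ) → IsLeast (λ k → 0 < k × (s a c d n 0 /ℕ g) ℤ.≤ + repunit a k) m →
    EmbeddingDimension (S a c d n) m
proposition3p10 (suc b) c (+ d) n (s≤s 1≤b) 0<c (ℤ.+<+ d<ca) d⊥a d⊥c 1≤n (ℤ.+<+ 0<d)
                g isGCD (suc p) ((s≤s z≤n , u/g≤R) , least) =
  embeddingDimension-resp-≐ (⟨Terms⟩⊆S , S⊆⟨Terms⟩)
    (subst (λ u → EmbeddingDimension ⟨ Terms b C u ⟩ (suc p)) (sym u≡gq)
      (terms-embeddingDimension b C q g k b≡gk
        (coprime-* q⊥k (λ {e} (e∣q , e∣C) → u⊥C (subst (e ∣_) (sym u≡gq) (∣n⇒∣m*n g e∣q) , e∣C)))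
        (≤-trans (≤-reflexive (sym u≡gq)) (m∸n≤m C d))
        R<q q≤R))
  where
  a = suc b
  C = c * a ^ n
  u = C ∸ d
  open IsGCD isGCD

  d<C : d < C
  d<C = <-≤-trans d<ca (*-monoʳ-≤ c (≤-trans (≤-reflexive (sym (*-identityʳ a))) (^-monoʳ-≤ a 1≤n)))
  d+u≡C : d + u ≡ C
  d+u≡C = m+[n∸m]≡n (<⇒≤ d<C)
  0<u : 0 < u
  0<u = m<n⇒0<n∸m d<C
  s≡ : ∀ j → s a c (+ d) n j ≡ + term b C u j
  s≡ = s≡term b c d n u d+u≡C

  S⊆⟨Terms⟩ : S a c (+ d) n ⊆ ⟨ Terms b C u ⟩
  S⊆⟨Terms⟩ = ⟨⟩-least λ (j , eq) → gen (j , ℤ.+-injective (trans eq (s≡ j)))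
  ⟨Terms⟩⊆S : ⟨ Terms b C u ⟩ ⊆ S a c (+ d) n
  ⟨Terms⟩⊆S = ⟨⟩-least λ { (j , refl) → gen (j , sym (s≡ j)) }

  u⊥C : Coprime u C
  u⊥C = coprime-summand d+u≡C (coprime-* (gcd≡1⇒coprime (ℤ.+-injective d⊥c))
    (coprime-^ (gcd≡1⇒coprime (ℤ.+-injective d⊥a)) n))

  g∣term : ∀ j → g ∣ term b C u j
  g∣term j = commonDivisor (gen (j , sym (s≡ j)))
  g∣u : g ∣ u
  g∣u = subst (g ∣_) (trans (cong (λ x → u + x) (*-zeroʳ (b * C))) (+-identityʳ u)) (g∣term 0)
  -- The first two terms differ by `b * C` because `R_1 = 1`, and `g`, a divisor of `u`, is coprime
  -- to `C`.
  g∣b : g ∣ b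
  g∣b = coprime-divisor (λ (e∣g , e∣C) → u⊥C (∣-trans e∣g g∣u , e∣C))
    (subst (g ∣_) (trans (*-identityʳ (b * C)) (*-comm b C)) (∣m+n∣m⇒∣n (g∣term 1) g∣u))

  q = quotient g∣u
  k = quotient g∣b
  u≡gq : u ≡ g * q
  u≡gq = trans (_∣_.equality g∣u) (*-comm q g)
  b≡gk : b ≡ g * k
  b≡gk = trans (_∣_.equality g∣b) (*-comm k g)

  -- Every term is a combination of `u` and `b`, so `g` is in fact the gcd of these two numbers.
  common∣g : ∀ {e} → e ∣ u → e ∣ b → e ∣ g
  common∣g {e} e∣u e∣b = greatest (multiple ∘ S⊆⟨Terms⟩)
    where
    multiple : ∀ {x} → x ∈ ⟨ Terms b C u ⟩ → e ∣ x
    multiple (gen (j , refl)) = ∣m∣n⇒∣m+n e∣u (∣m⇒∣m*n (repunit a j) (∣m⇒∣m*n C e∣b))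
    multiple zero             = divides 0 refl
    multiple (add x∈ y∈)      = ∣m∣n⇒∣m+n (multiple x∈) (multiple y∈)

  -- If `e` divides both cofactors, then `g * e` divides `u` and `b`, hence `g`, which forces
  -- `e = 1`.
  q⊥k : Coprime q k
  q⊥k {e} (e∣q , e∣k) = ∣1⇒≡1 (*-cancelˡ-∣ g (subst (g * e ∣_) (sym (*-identityʳ g))
    (common∣g (subst (g * e ∣_) (sym u≡gq) (*-monoʳ-∣ g e∣q))
              (subst (g * e ∣_) (sym b≡gk) (*-monoʳ-∣ g e∣k)))))

  instance
    q≢0 : NonZero q
    q≢0 = m*n≢0⇒n≢0 g {{>-nonZero (≤-trans 0<u (≤-reflexive u≡gq))}}
    k≢0 : NonZero k
    k≢0 = m*n≢0⇒n≢0 g {{>-nonZero (≤-trans 1≤b (≤-reflexive b≡gk))}}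
    C≢0 : NonZero C
    C≢0 = >-nonZero (≤-<-trans z≤n d<C)

  -- The rounding division is exact here, as `g` divides `s_0 = u`.
  s₀/g≡q : s a c (+ d) n 0 /ℕ g ≡ + q
  s₀/g≡q = trans (cong (_/ℕ g) (s≡ 0)) (cong +_ (trans (/-congˡ
    (trans (trans (cong (λ x → u + x) (*-zeroʳ (b * C))) (+-identityʳ u)) (_∣_.equality g∣u)))
    (m*n/n≡m q g)))

  q≤R : q ≤ repunit a (suc p)
  q≤R = ℤ.drop‿+≤+ (subst (ℤ._≤ _) s₀/g≡q u/g≤R)

  R<q : repunit a p < q
  -- Otherwise `p` would already satisfy the condition whose least solution is `suc p`; it is
  -- positive because `0 < q ≤ R_p` while `R_0 = 0`.
  R<q = ≰⇒> λ q≤Rp → <-irrefl refl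
    (least (0<repunit⇒0< a (<-≤-trans (>-nonZero⁻¹ q) q≤Rp) ,
            subst (ℤ._≤ _) (sym s₀/g≡q) (ℤ.+≤+ q≤Rp)))
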